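{- Let $G$ be a finite graph and let $\mathcal{T}$ be a tree-cut decomposition of $G$. Then: (i) if $\mathcal{T}$ has GPRTW's width $k$, then $\mathcal{T}$ has adhesion-width $\leq k^2$ and bag-width $\leq k$; (ii) if $\mathcal{T}$ has adhesion-width $a$ and bag-width $b$, then $\mathcal{T}$ has GPRTW's width $\leq a+b+2$.
   Context: Graphs are finite and undirected; parallel edges are allowed, loops are not. A near-partition of a set $\Omega$ is a family of pairwise disjoint (possibly empty) subsets of $\Omega$ with union $\Omega$. A tree-cut decomposition of $G$ is a pair $\mathcal{T}=(T,\mathcal{X})$ where $T$ is a tree and $\mathcal{X}=\{X_t : t\in V(T)\}$ is a near-partition of $V(G)$ indexed by the nodes of $T$; $X_t$ is the bag of $t$. For an edge $st$ of $T$, $\mathrm{adh}(st)$ is the set of edges $uv$ of $G$ such that the node whose bag contains $u$ and the node whose bag contains $v$ lie in different components of $T-st$. The edge $st$ is bold if $|\mathrm{adh}(st)|\geq 3$ and thin otherwise. For a node $t$, $\mathrm{adh}(t)$ is the union of the sets $\mathrm{adh}(st)$ over all bold edges $st$ of $T$ incident to $t$. The adhesion-width of $\mathcal{T}$ is $\max_{t\in V(T)}|\mathrm{adh}(t)|$ and the bag-width of $\mathcal{T}$ is $\max_{t\in V(T)}|X_t|$. For a node $t$ of $T$ let $w_t := |X_t| + |\{t'\in N_T(t) : |\mathrm{adh}(tt')|\geq 3\}|$, where $N_T(t)$ is the set of neighbors of $t$ in $T$. The GPRTW's width of $\mathcal{T}$ is $\max\left(\{|\mathrm{adh}(e)| :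 e\in E(T)\}\cup\{w_t : t\in V(T)\}\right)$. -}

module Defs where

open import Data.Fin.Base using (Fin)
open import Data.Fin.Properties using (any?; _≟_)
open import Data.Fin.Subset using (Subset; _∈_; _∩_; ⊤; _-_; ⋃; ∣_∣; Empty)
open import Data.Fin.Subset.Properties using (_∈?_)
open import Data.List.Base using (List; []; _∷_; _++_; map; filter; allFin)
open import Data.List.Extrema.Nat using (max)
open import Data.List.Membership.Propositional using () renaming (_∈_ to _∈ₗ_)
open import Data.List.Membership.Propositional.Properties using (∈-allFin)
open import Data.List.Relation.Unary.Any using (here; there)
open import Data.List.Relation.Unary.Unique.Propositional using (Unique)
open import Data.Nat.Base using (ℕ; NonZero; _+_; _≤_)
open import Data.Nat.Properties using (_≤?_)
open import Data.Product.Base using (∃; _×_; _,_; proj₁; proj₂)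
open import Data.Product.Properties using (≡-dec)
open import Data.Sum.Base using (_⊎_; inj₁; inj₂)
open import Data.Vec.Base using (tabulate)
open import Function.Base using (_∘_)
open import Level using (Level)
open import Relation.Binary.Construct.Closure.ReflexiveTransitive using (Star; ε; _◅_; _◅◅_)
open import Relation.Binary.Core using (Rel)
open import Relation.Binary.Definitions using (Decidable)
open import Relation.Binary.PropositionalEquality using (_≡_; _≢_; refl)
open import Relation.Nullary using (¬_; Dec; does)
open import Relation.Nullary.Decidable using (map′; ¬?; _×-dec_; _⊎-dec_)
open import Relation.Unary using (Pred) renaming (Decidable to Decidable₁)

private
  variable
    ℓ : Level
    n : ℕ

⟪_⟫ : {P : Pred (Fin n) ℓ} → Decidable₁ P → Subset n
⟪ P? ⟫ = tabulate (does ∘ P?)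

-- Reachability in a finite decidable relation is decidable: `Via L x y` says
-- that y can be reached from x in at least zero steps with all intermediate
-- points in L (the Floyd–Warshall recursion).

module _ {R : Rel (Fin n) ℓ} (R? : Decidable R) where

  private
    Via : List (Fin n) → Rel (Fin n) ℓ
    Via []      x y = (x ≡ y) ⊎ R x y
    Via (z ∷ L) x y = Via L x y ⊎ (Via L x z × Via L z y)

    via? : ∀ L → Decidable (Via L)
    via? []      x y = (x ≟ y) ⊎-dec R? x y
    via? (z ∷ L) x y = via? L x y ⊎-dec (via? L x z ×-dec via? L z y)

    sound : ∀ L {x y} → Via L x y → Star R x y
    sound []      (inj₁ refl)    = ε
    sound []      (inj₂ r)       = r ◅ ε
    sound (z ∷ L) (inj₁ p)       = sound L p
    sound (z ∷ L) (inj₂ (p , q)) = sound L p ◅◅ sound L q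

    base : ∀ L {x y} → (x ≡ y) ⊎ R x y → Via L x y
    base []      r = r
    base (z ∷ L) r = inj₁ (base L r)

    join : ∀ L {x y z} → y ∈ₗ L → Via L x y → Via L y z → Via L x z
    join (_ ∷ L) (here refl) (inj₁ p)       (inj₁ q)       = inj₂ (p , q)
    join (_ ∷ L) (here refl) (inj₁ p)       (inj₂ (_ , q)) = inj₂ (p , q)
    join (_ ∷ L) (here refl) (inj₂ (p , _)) (inj₁ q)       = inj₂ (p , q)
    join (_ ∷ L) (here refl) (inj₂ (p , _)) (inj₂ (_ , q)) = inj₂ (p , q)
    join (_ ∷ L) (there i)   (inj₁ p)       (inj₁ q)       = inj₁ (join L i p q)
    join (_ ∷ L) (there i)   (inj₁ p)       (inj₂ (q , r)) = inj₂ (join L i p q , r)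
    join (_ ∷ L) (there i)   (inj₂ (p , q)) (inj₁ r)       = inj₂ (p , join L i q r)
    join (_ ∷ L) (there i)   (inj₂ (p , _)) (inj₂ (_ , r)) = inj₂ (p , r)

    complete : ∀ {x y} → Star R x y → Via (allFin n) x y
    complete ε        = base (allFin n) (inj₁ refl)
    complete (r ◅ rs) = join (allFin n) (∈-allFin _) (base (allFin n) (inj₂ r)) (complete rs)

  star? : Decidable (Star R)
  star? x y = map′ (sound (allFin n)) complete (via? (allFin n) x y)

-- Distinct edges may have the same ends, so parallel edges are allowed. The
-- order in which `ends` lists the two ends of an edge carries no meaning:
-- `Joins` is symmetric.

record Graph : Set where
  field
    order    : ℕ
    size     : ℕ
    ends     : Fin size → Fin order × Fin order
    loopless : ∀ e → proj₁ (ends e) ≢ proj₂ (ends e)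

  Vertex Edge : Set
  Vertex = Fin order
  Edge   = Fin size

  Joins : Edge → Vertex → Vertex → Set
  Joins e u v = (ends e ≡ (u , v)) ⊎ (ends e ≡ (v , u))

  joins? : ∀ e u v → Dec (Joins e u v)
  joins? e u v = ≡-dec _≟_ _≟_ (ends e) (u , v) ⊎-dec ≡-dec _≟_ _≟_ (ends e) (v , u)

  Incident : Edge → Vertex → Set
  Incident e v = (proj₁ (ends e) ≡ v) ⊎ (proj₂ (ends e) ≡ v)

  incident? : ∀ e v → Dec (Incident e v)
  incident? e v = (proj₁ (ends e) ≟ v) ⊎-dec (proj₂ (ends e) ≟ v)

  -- Steps and walks in the spanning subgraph with edge set F; in particular
  -- `Walk ⊤` is for the graph itself and `Walk (⊤ - e)` for the graph with
  -- the edge e deleted.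

  Step : Subset size → Rel Vertex _
  Step F u v = ∃ λ e → e ∈ F × Joins e u v

  step? : ∀ F → Decidable (Step F)
  step? F u v = any? λ e → (e ∈? F) ×-dec joins? e u v

  Walk : Subset size → Rel Vertex _
  Walk F = Star (Step F)

  walk? : ∀ F → Decidable (Walk F)
  walk? F = star? (step? F)

  edges : ∀ {F u v} → Walk F u v → List Edge
  edges ε             = []
  edges ((e , _) ◅ p) = e ∷ edges p

  -- All vertices of a walk except the last one.
  sources : ∀ {F u v} → Walk F u v → List Vertex
  sources ε                 = []
  sources (_◅_ {i = u} _ p) = u ∷ sources p

  -- Edges are required to be distinct so that traversing one edge back and
  -- forth is not a cycle, whereas two parallel edges form one.
  IsCycle : ∀ {v} → Walk ⊤ v v → Set
  IsCycle p = edges p ≢ [] × Unique (sources p) × Unique (edges p)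

  Connected : Set
  Connected = NonZero order × (∀ u v → Walk ⊤ u v)

  Acyclic : Set
  Acyclic = ∀ {v} (p : Walk ⊤ v v) → ¬ IsCycle p

  IsTree : Set
  IsTree = Connected × Acyclic

  DifferentComponents : Subset size → Vertex → Vertex → Set
  DifferentComponents F u v = ¬ Walk F u v

record TreeCutDecomposition (G : Graph) : Set where
  private
    module G = Graph G
  field
    tree   : Graph
    isTree : Graph.IsTree tree

  open Graph tree public
    using () renaming (Vertex to Node; Edge to Link; order to #nodes; size to #links)
  private
    module T = Graph tree

  field
    bag      : Node → Subset G.order
    disjoint : ∀ {s t} → s ≢ t → Empty (bag s ∩ bag t)
    covering : ∀ v → ∃ λ t → v ∈ bag t

  -- By disjointness, this is the only node whose bag contains v.
  nodeOf : G.Vertex → Node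
  nodeOf v = proj₁ (covering v)

  Crosses : G.Edge → Link → Set
  Crosses f e = T.DifferentComponents (⊤ - e)
                  (nodeOf (proj₁ (G.ends f))) (nodeOf (proj₂ (G.ends f)))

  crosses? : ∀ f e → Dec (Crosses f e)
  crosses? f e = ¬? (T.walk? (⊤ - e) _ _)

  adh : Link → Subset G.size
  adh e = ⟪ (λ f → crosses? f e) ⟫

  Bold : Link → Set
  Bold e = 3 ≤ ∣ adh e ∣

  bold? : ∀ e → Dec (Bold e)
  bold? e = 3 ≤? ∣ adh e ∣

  adhₙ : Node → Subset G.size
  adhₙ t = ⋃ (map adh (filter (λ e → bold? e ×-dec T.incident? e t) (allFin #links)))

  boldNeighbours : Node → Subset #nodes
  boldNeighbours t = ⟪ (λ t′ → any? λ e → T.joins? e t t′ ×-dec bold? e) ⟫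

  w : Node → ℕ
  w t = ∣ bag t ∣ + ∣ boldNeighbours t ∣

  -- The maxima below are of sets of naturals that are nonempty, since a tree
  -- has a node; the default value 0 passed to `max` does not affect them.

  adhesionWidth : ℕ
  adhesionWidth = max 0 (map (λ t → ∣ adhₙ t ∣) (allFin #nodes))

  bagWidth : ℕ
  bagWidth = max 0 (map (λ t → ∣ bag t ∣) (allFin #nodes))

  gprtwWidth : ℕ
  gprtwWidth = max 0 (map (λ e → ∣ adh e ∣) (allFin #links) ++ map w (allFin #nodes))

{-# OPTIONS --safe #-}
-- For the first part, a tree has no parallel links, so a node t has as many
-- bold links as bold neighbours: at most k, each of adhesion at most k.
-- For the second part, the crux is that t has at most |adh(t)| bold links.
-- A walk in the tree from one end of an edge f to t, followed until its first
-- visit to t, uses only one link at t; so among the links at t at most one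
-- separates that end from t. Hence f crosses at most two links at t, and
-- double counting the pairs (f, e) with f ∈ adh(e) gives 2 · #bold ≤ 2 |adh(t)|,
-- where each bold e is only used to have |adh(e)| ≥ 2.
module Submission where

open import Defs
open import Algebra.Properties.CommutativeSemigroup using (interchange)
open import Data.Bool.Base using (if_then_else_)
open import Data.Fin.Base using (Fin)
open import Data.Fin.Properties using (any?; _≟_)
open import Data.Fin.Subset
  using (Subset; inside; outside; _∈_; _⊆_; _∩_; _∪_; ⊤; ⊥; _-_; ⁅_⁆; ⋃; ∣_∣; Empty)
open import Data.Fin.Subset.Properties
open import Data.List.Base using (List; []; _∷_; map; filter; allFin; length)
open import Data.List.Extrema.Nat using (max; xs≤max; max≤v⁺)
open import Data.List.Membership.Propositional using (lose)
open import Data.List.Membership.Propositional.Properties using (∈-allFin; ∈-filter⁺)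
open import Data.List.Relation.Unary.All using (All; []; _∷_)
import Data.List.Relation.Unary.All as All
import Data.List.Relation.Unary.All.Properties as All
open import Data.List.Relation.Unary.Any using (Any; here; there)
import Data.List.Relation.Unary.Any as Any
import Data.List.Relation.Unary.Any.Properties as Any
open import Data.List.Relation.Unary.AllPairs using (AllPairs; []; _∷_)
open import Data.List.Relation.Unary.Unique.Propositional using (Unique)
import Data.List.Relation.Unary.Unique.Propositional.Properties as Unique
open import Data.Nat.Base using (ℕ; suc; z≤n; s≤s⁻¹; _+_; _*_; _^_; _≤_)
open import Data.Nat.ListAction using (sum)
open import Data.Nat.Properties hiding (_≟_)
open import Data.Product.Base using (∃; _×_; _,_; proj₁; proj₂)
open import Data.Sum.Base using (inj₁; inj₂; swap; [_,_]′)
open import Data.Vec.Base using ([]; _∷_)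
open import Data.Vec.Properties using (lookup∘tabulate; lookup⇒[]=; []=⇒lookup)
open import Function.Base using (_∘_)
open import Level using (Level)
open import Relation.Binary.Construct.Closure.ReflexiveTransitive using (ε; _◅_; _◅◅_; reverse)
open import Relation.Binary.Core using (Rel)
open import Relation.Binary.PropositionalEquality
  using (_≡_; _≢_; refl; sym; trans; cong; subst; module ≡-Reasoning)
open import Relation.Nullary using (Dec; yes; no; does; contradiction)
open import Relation.Nullary.Decidable using (dec-true; decidable-stable; ¬?; _×-dec_)
open import Relation.Unary using (Pred) renaming (Decidable to Decidable₁)
open TreeCutDecomposition using (gprtwWidth; adhesionWidth; bagWidth)

private
  variable
    ℓ ℓ′ ℓ″ : Level
    n : ℕ
    A : Set ℓ

-- Finite subsets: comprehension, unions and counting.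

∈-⟪⟫⁺ : {P : Pred (Fin n) ℓ} (P? : Decidable₁ P) → ∀ {x} → P x → x ∈ ⟪ P? ⟫
∈-⟪⟫⁺ P? {x} px = lookup⇒[]= x _ (trans (lookup∘tabulate (does ∘ P?) x) (dec-true (P? x) px))

∈-⟪⟫⁻ : {P : Pred (Fin n) ℓ} (P? : Decidable₁ P) → ∀ {x} → x ∈ ⟪ P? ⟫ → P x
∈-⟪⟫⁻ P? {x} x∈ with P? x | trans (sym (lookup∘tabulate (does ∘ P?) x)) ([]=⇒lookup x∈)
... | yes px | _ = px
... | no  _  | ()

∈-⋃⁺ : ∀ {ps : List (Subset n)} {x} → Any (x ∈_) ps → x ∈ ⋃ ps
∈-⋃⁺ (here x∈p) = x∈p∪q⁺ (inj₁ x∈p)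
∈-⋃⁺ (there i)  = x∈p∪q⁺ (inj₂ (∈-⋃⁺ i))

∈-⋃⁻ : ∀ (ps : List (Subset n)) {x} → x ∈ ⋃ ps → Any (x ∈_) ps
∈-⋃⁻ []       x∈ = contradiction x∈ ∉⊥
∈-⋃⁻ (p ∷ ps) x∈ = [ here , there ∘ ∈-⋃⁻ ps ]′ (x∈p∪q⁻ p (⋃ ps) x∈)

-- Inclusion-exclusion in additive form, which avoids truncated subtraction.
∣p∪q∣+∣p∩q∣≡∣p∣+∣q∣ : ∀ (p q : Subset n) → ∣ p ∪ q ∣ + ∣ p ∩ q ∣ ≡ ∣ p ∣ + ∣ q ∣
∣p∪q∣+∣p∩q∣≡∣p∣+∣q∣ []            []            = refl
∣p∪q∣+∣p∩q∣≡∣p∣+∣q∣ (outside ∷ p) (outside ∷ q) = ∣p∪q∣+∣p∩q∣≡∣p∣+∣q∣ p q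
∣p∪q∣+∣p∩q∣≡∣p∣+∣q∣ (inside  ∷ p) (outside ∷ q) = cong suc (∣p∪q∣+∣p∩q∣≡∣p∣+∣q∣ p q)
∣p∪q∣+∣p∩q∣≡∣p∣+∣q∣ (outside ∷ p) (inside  ∷ q) =
  trans (cong suc (∣p∪q∣+∣p∩q∣≡∣p∣+∣q∣ p q)) (sym (+-suc _ _))
∣p∪q∣+∣p∩q∣≡∣p∣+∣q∣ (inside  ∷ p) (inside  ∷ q) =
  cong suc (trans (+-suc _ _) (trans (cong suc (∣p∪q∣+∣p∩q∣≡∣p∣+∣q∣ p q)) (sym (+-suc _ _))))

∣p∪q∣≤∣p∣+∣q∣ : ∀ (p q : Subset n) → ∣ p ∪ q ∣ ≤ ∣ p ∣ + ∣ q ∣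
∣p∪q∣≤∣p∣+∣q∣ p q = ≤-trans (m≤m+n _ _) (≤-reflexive (∣p∪q∣+∣p∩q∣≡∣p∣+∣q∣ p q))

disjoint⇒∣p∣+∣q∣≡∣p∪q∣ : ∀ (p q : Subset n) → Empty (p ∩ q) → ∣ p ∣ + ∣ q ∣ ≡ ∣ p ∪ q ∣
disjoint⇒∣p∣+∣q∣≡∣p∪q∣ {n} p q p∩q=∅ = begin
  ∣ p ∣ + ∣ q ∣          ≡⟨ ∣p∪q∣+∣p∩q∣≡∣p∣+∣q∣ p q ⟨
  ∣ p ∪ q ∣ + ∣ p ∩ q ∣  ≡⟨ cong (λ r → ∣ p ∪ q ∣ + ∣ r ∣) (Empty-unique p∩q=∅) ⟩
  ∣ p ∪ q ∣ + ∣ ⊥ {n} ∣  ≡⟨ cong (∣ p ∪ q ∣ +_) (∣⊥∣≡0 n) ⟩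
  ∣ p ∪ q ∣ + 0          ≡⟨ +-identityʳ _ ⟩
  ∣ p ∪ q ∣              ∎
  where open ≡-Reasoning

module _ {A : Set ℓ} (p : A → Subset n) where

  ∣⋃∣≤length* : ∀ {k xs} → All (λ x → ∣ p x ∣ ≤ k) xs → ∣ ⋃ (map p xs) ∣ ≤ length xs * k
  ∣⋃∣≤length* []             = ≤-reflexive (∣⊥∣≡0 n)
  ∣⋃∣≤length* (px≤k ∷ ps≤k) =
    ≤-trans (∣p∪q∣≤∣p∣+∣q∣ (p _) _) (+-mono-≤ px≤k (∣⋃∣≤length* ps≤k))

  Disjoint : A → A → Set
  Disjoint x y = Empty (p x ∩ p y)

  sum≤∣⋃∣ : ∀ {xs} → AllPairs Disjoint xs → sum (map (∣_∣ ∘ p) xs) ≤ ∣ ⋃ (map p xs) ∣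
  sum≤∣⋃∣ []                 = z≤n
  sum≤∣⋃∣ {x ∷ xs} (d ∷ ds) = begin
    ∣ p x ∣ + sum (map (∣_∣ ∘ p) xs)  ≤⟨ +-monoʳ-≤ ∣ p x ∣ (sum≤∣⋃∣ ds) ⟩
    ∣ p x ∣ + ∣ ⋃ (map p xs) ∣        ≡⟨ disjoint⇒∣p∣+∣q∣≡∣p∪q∣ (p x) _ d′ ⟩
    ∣ p x ∪ ⋃ (map p xs) ∣            ∎
    where
    open ≤-Reasoning
    d′ : Empty (p x ∩ ⋃ (map p xs))
    d′ (z , z∈) with x∈p∩q⁻ (p x) _ z∈
    ... | z∈px , z∈⋃ =
      All.lookupWith (λ px∩py=∅ z∈py → px∩py=∅ (z , x∈p∩q⁺ (z∈px , z∈py))) d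
        (Any.map⁻ (∈-⋃⁻ (map p xs) z∈⋃))

-- Half of a double count: `f` and `g` will be the sizes of the two sides into which an adhesion is
-- split, one for each end of the crossing edges.
length*≤sum+sum : ∀ {k} (f g : A → ℕ) {xs} → All (λ x → k ≤ f x + g x) xs →
                  length xs * k ≤ sum (map f xs) + sum (map g xs)
length*≤sum+sum f g [] = z≤n
length*≤sum+sum {k = k} f g {x ∷ xs} (k≤ ∷ ks≤) = begin
  k + length xs * k                                ≤⟨ +-mono-≤ k≤ (length*≤sum+sum f g ks≤) ⟩
  (f x + g x) + (sum (map f xs) + sum (map g xs))  ≡⟨ interchange +-commutativeSemigroup (f x) (g x) _ _ ⟩
  (f x + sum (map f xs)) + (g x + sum (map g xs))  ∎
  where open ≤-Reasoning

-- Supplies the disjointness hypothesis of `sum≤∣⋃∣`; `P` carries what all entries share, later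
-- being bold and incident to a fixed node.
unique⇒allPairs : {P : Pred A ℓ′} {R : Rel A ℓ″} → (∀ {x y} → P x → P y → x ≢ y → R x y) →
                  ∀ {xs} → All P xs → Unique xs → AllPairs R xs
unique⇒allPairs r []         []         = []
unique⇒allPairs r (px ∷ pxs) (x∉xs ∷ u) =
  All.zipWith (λ (py , x≢y) → r px py x≢y) (pxs , x∉xs) ∷ unique⇒allPairs r pxs u

-- Graphs: ends of edges, parallel edges, and edges separating two vertices.

module GraphProperties (G : Graph) where
  open Graph G

  walk-reverse : ∀ {F u v} → Walk F u v → Walk F v u
  walk-reverse = reverse λ (e , e∈F , j) → e , e∈F , swap j

  -- Meaningful only for edges incident to v.
  otherEnd : Vertex → Edge → Vertex
  otherEnd v e = if does (proj₁ (ends e) ≟ v) then proj₂ (ends e) else proj₁ (ends e)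

  joins⇒otherEnd : ∀ {e u v} → Joins e u v → otherEnd u e ≡ v
  joins⇒otherEnd {e} {u} j with proj₁ (ends e) ≟ u | j
  ... | yes _   | inj₁ refl = refl
  ... | yes p≡u | inj₂ refl = sym p≡u
  ... | no  p≢u | inj₁ refl = contradiction refl p≢u
  ... | no  _   | inj₂ refl = refl

  incident⇒joins : ∀ {e v} → Incident e v → Joins e v (otherEnd v e)
  incident⇒joins {e} {v} i with proj₁ (ends e) ≟ v | i
  ... | yes refl | _         = inj₁ refl
  ... | no  p≢v  | inj₁ p≡v  = contradiction p≡v p≢v
  ... | no  _    | inj₂ refl = inj₂ refl

  joins⇒incidentˡ : ∀ {e u v} → Joins e u v → Incident e u
  joins⇒incidentˡ (inj₁ refl) = inj₁ refl
  joins⇒incidentˡ (inj₂ refl) = inj₂ refl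

  joins⇒≢ : ∀ {e u v} → Joins e u v → u ≢ v
  joins⇒≢ (inj₁ refl) = loopless _
  joins⇒≢ (inj₂ refl) = loopless _ ∘ sym

  -- Going along one edge and back along a different parallel one is a cycle of length two;
  -- looplessness makes its two sources distinct.
  acyclic⇒simple : Acyclic → ∀ {e e′ u v} → Joins e u v → Joins e′ u v → e ≡ e′
  acyclic⇒simple acyclic {e} {e′} j j′ = decidable-stable (e ≟ e′) λ e≢e′ →
    acyclic ((e , ∈⊤ , j) ◅ (e′ , ∈⊤ , swap j′) ◅ ε)
      ( (λ ())
      , (joins⇒≢ j ∷ []) ∷ [] ∷ []
      , (e≢e′ ∷ []) ∷ [] ∷ [] )

  otherEnd-injective : Acyclic → ∀ {v e e′} → Incident e v → Incident e′ v →
                       otherEnd v e ≡ otherEnd v e′ → e ≡ e′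
  otherEnd-injective acyclic {v} i i′ eq = acyclic⇒simple acyclic
    (incident⇒joins i) (subst (Joins _ v) (sym eq) (incident⇒joins i′))

  Separates : Vertex → Edge → Vertex → Set
  Separates t e v = DifferentComponents (⊤ - e) v t

  separates? : ∀ t e v → Dec (Separates t e v)
  separates? t e v = ¬? (walk? (⊤ - e) v t)

  step-avoiding : ∀ {e f u v} → Joins f u v → f ≢ e → Step (⊤ - e) u v
  step-avoiding j f≢e = _ , x∈p∧x≢y⇒x∈p-y ∈⊤ f≢e , j

  -- Induction on the walk, cut off at its first visit to `t`: the edge by which it arrives there is
  -- the only candidate for a separating edge at `t`.
  separator-unique : ∀ {t v} → Walk ⊤ v t → ∀ {e e′} → Incident e t → Incident e′ t →
                     Separates t e v → Separates t e′ v → e ≡ e′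
  separator-unique ε s s′ sep sep′ = contradiction ε sep
  separator-unique {t} {v} (_◅_ {j = v′} (f , _ , j) p) {e} {e′} i i′ sep sep′
    with v′ ≟ t
  -- The edge `f` alone is a walk from `v` to `t`, so an edge separating them must be `f`. The rest
  -- `p` of the walk is dropped.
  ... | yes refl = trans (sym (f≡ sep)) (f≡ sep′)
    where
    f≡ : ∀ {e} → Separates t e v → f ≡ e
    f≡ {e} sep = decidable-stable (f ≟ e) λ f≢e → sep (step-avoiding j f≢e ◅ ε)
  -- Neither end of `f` is `t`, so `f` is neither `e` nor `e′`, and both still separate `v′` from
  -- `t`.
  ... | no v′≢t = separator-unique p i i′ (sep ∘ extend i sep) (sep′ ∘ extend i′ sep′)
    where
    ends-at-t : ∀ {f} → Joins f v v′ → Incident f t → v ≢ t → v′ ≡ t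
    ends-at-t (inj₁ refl) (inj₁ v≡t)  v≢t = contradiction v≡t v≢t
    ends-at-t (inj₁ refl) (inj₂ v′≡t) v≢t = v′≡t
    ends-at-t (inj₂ refl) (inj₁ v′≡t) v≢t = v′≡t
    ends-at-t (inj₂ refl) (inj₂ v≡t)  v≢t = contradiction v≡t v≢t

    extend : ∀ {e} → Incident e t → Separates t e v → Walk (⊤ - e) v′ t → Walk (⊤ - e) v t
    extend i sep q = step-avoiding j
      -- Were `f` equal to `e`, one of its ends would be `t`. It is not `v`, since the empty walk
      -- would contradict `sep`, so it would be `v′`.
      (λ { refl → v′≢t (ends-at-t j i λ { refl → sep ε }) }) ◅ q

-- Tree-cut decompositions: counting the bold links at a node.

module _ (G : Graph) (𝒯 : TreeCutDecomposition G) where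
  open Graph G using (ends; size; Vertex)
  open TreeCutDecomposition 𝒯
    hiding (gprtwWidth; adhesionWidth; bagWidth)
  open Graph tree using (Incident; incident?; Joins; joins?; walk?)
  open GraphProperties tree

  BoldAt : Node → Link → Set
  BoldAt t e = Bold e × Incident e t

  boldAt? : ∀ t e → Dec (BoldAt t e)
  boldAt? t e = bold? e ×-dec incident? e t

  -- `adhₙ t` unfolds to `⋃ (map adh (boldLinks t))`, so bounds on unions over this list apply to it
  -- directly.
  boldLinks : Node → List Link
  boldLinks t = filter (boldAt? t) (allFin #links)

  all-boldAt : ∀ t → All (BoldAt t) (boldLinks t)
  all-boldAt t = All.all-filter (boldAt? t) (allFin #links)

  boldLinks-unique : ∀ t → Unique (boldLinks t)
  boldLinks-unique t = Unique.filter⁺ (boldAt? t) (Unique.allFin⁺ #links)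

  adh⊆adhₙ : ∀ {t e} → BoldAt t e → adh e ⊆ adhₙ t
  adh⊆adhₙ {t} b f∈ =
    ∈-⋃⁺ (Any.map⁺ (lose (∈-filter⁺ (boldAt? t) (∈-allFin _) b) f∈))

  -- The decision procedure inside `boldNeighbours`, named so that `∈-⟪⟫⁺` and `∈-⟪⟫⁻` can be
  -- applied to it.
  boldNeighbour? : ∀ t t′ → Dec (∃ λ e → Joins e t t′ × Bold e)
  boldNeighbour? t t′ = any? λ e → joins? e t t′ ×-dec bold? e

  -- The singletons of the other ends of the bold links at `t` cover the bold neighbours.
  ∣boldNeighbours∣≤∣boldLinks∣ : ∀ t → ∣ boldNeighbours t ∣ ≤ length (boldLinks t)
  ∣boldNeighbours∣≤∣boldLinks∣ t = begin
    ∣ boldNeighbours t ∣                           ≤⟨ p⊆q⇒∣p∣≤∣q∣ covered ⟩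
    ∣ ⋃ (map (⁅_⁆ ∘ otherEnd t) (boldLinks t)) ∣   ≤⟨ ∣⋃∣≤length* (⁅_⁆ ∘ otherEnd t)
                                                        (All.universal (λ e → ≤-reflexive (∣⁅x⁆∣≡1 (otherEnd t e))) (boldLinks t)) ⟩
    length (boldLinks t) * 1                       ≡⟨ *-identityʳ _ ⟩
    length (boldLinks t)                           ∎
    where
    open ≤-Reasoning
    covered : boldNeighbours t ⊆ ⋃ (map (⁅_⁆ ∘ otherEnd t) (boldLinks t))
    covered {t′} t′∈ with ∈-⟪⟫⁻ (boldNeighbour? t) t′∈
    ... | e , j , b = ∈-⋃⁺ (Any.map⁺ (lose
      (∈-filter⁺ (boldAt? t) (∈-allFin e) (b , joins⇒incidentˡ j))
      (subst (λ u → t′ ∈ ⁅ u ⁆) (sym (joins⇒otherEnd j)) (x∈⁅x⁆ t′))))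

  -- Here the tree matters: without parallel links, distinct links at `t` have distinct other ends,
  -- so the singletons are disjoint.
  ∣boldLinks∣≤∣boldNeighbours∣ : ∀ t → length (boldLinks t) ≤ ∣ boldNeighbours t ∣
  ∣boldLinks∣≤∣boldNeighbours∣ t = begin
    length (boldLinks t)                                 ≡⟨ length≡sum (boldLinks t) ⟩
    sum (map (∣_∣ ∘ ⁅_⁆ ∘ otherEnd t) (boldLinks t))     ≤⟨ sum≤∣⋃∣ (⁅_⁆ ∘ otherEnd t)
                                                              (unique⇒allPairs disjoint-ends (all-boldAt t) (boldLinks-unique t)) ⟩
    ∣ ⋃ (map (⁅_⁆ ∘ otherEnd t) (boldLinks t)) ∣         ≤⟨ p⊆q⇒∣p∣≤∣q∣ neighbours ⟩
    ∣ boldNeighbours t ∣                                 ∎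
    where
    open ≤-Reasoning
    length≡sum : ∀ es → length es ≡ sum (map (∣_∣ ∘ ⁅_⁆ ∘ otherEnd t) es)
    length≡sum []       = refl
    length≡sum (e ∷ es) rewrite ∣⁅x⁆∣≡1 (otherEnd t e) = cong suc (length≡sum es)

    disjoint-ends : ∀ {e e′} → BoldAt t e → BoldAt t e′ → e ≢ e′ →
                    Empty (⁅ otherEnd t e ⁆ ∩ ⁅ otherEnd t e′ ⁆)
    disjoint-ends (_ , i) (_ , i′) e≢e′ (z , z∈) with x∈p∩q⁻ ⁅ _ ⁆ ⁅ _ ⁆ z∈
    ... | z∈ₑ , z∈ₑ′ = e≢e′ (otherEnd-injective (proj₂ isTree) i i′
      (trans (sym (x∈⁅y⁆⇒x≡y _ z∈ₑ)) (x∈⁅y⁆⇒x≡y _ z∈ₑ′)))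

    neighbours : ⋃ (map (⁅_⁆ ∘ otherEnd t) (boldLinks t)) ⊆ boldNeighbours t
    neighbours z∈ with All.lookupAny (all-boldAt t) (Any.map⁻ (∈-⋃⁻ (map _ (boldLinks t)) z∈))
    ... | (b , i) , z∈e = subst (_∈ boldNeighbours t) (sym (x∈⁅y⁆⇒x≡y _ z∈e))
      (∈-⟪⟫⁺ (boldNeighbour? t) (_ , incident⇒joins i , b))

  -- Applied with `end` one of the two projections.
  cutSide : (Vertex × Vertex → Vertex) → Node → Link → Subset size
  cutSide end t e = adh e ∩ ⟪ (λ f → separates? t e (nodeOf (end (ends f)))) ⟫

  -- By `separator-unique`, an end of a graph edge is separated from `t` by at most one link at `t`.
  -- Hence the sides of distinct links are disjoint, and all of them lie in `adhₙ t`.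
  sum-cutSide≤∣adhₙ∣ : ∀ end t → sum (map (∣_∣ ∘ cutSide end t) (boldLinks t)) ≤ ∣ adhₙ t ∣
  sum-cutSide≤∣adhₙ∣ end t = ≤-trans
    (sum≤∣⋃∣ (cutSide end t) (unique⇒allPairs disjoint-sides (all-boldAt t) (boldLinks-unique t)))
    (p⊆q⇒∣p∣≤∣q∣ sides⊆adhₙ)
    where
    side⁻ : ∀ {e f} → f ∈ cutSide end t e → f ∈ adh e × Separates t e (nodeOf (end (ends f)))
    side⁻ {e} f∈ with x∈p∩q⁻ (adh e) _ f∈
    ... | f∈adh , f∈sep = f∈adh , ∈-⟪⟫⁻ (λ f → separates? t e (nodeOf (end (ends f)))) f∈sep

    disjoint-sides : ∀ {e e′} → BoldAt t e → BoldAt t e′ → e ≢ e′ →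
                     Empty (cutSide end t e ∩ cutSide end t e′)
    disjoint-sides {e} {e′} (_ , i) (_ , i′) e≢e′ (f , f∈)
      with x∈p∩q⁻ (cutSide end t e) (cutSide end t e′) f∈
    ... | f∈e , f∈e′ = e≢e′ (separator-unique (proj₂ (proj₁ isTree) _ t) i i′
                              (proj₂ (side⁻ f∈e)) (proj₂ (side⁻ f∈e′)))

    sides⊆adhₙ : ⋃ (map (cutSide end t) (boldLinks t)) ⊆ adhₙ t
    sides⊆adhₙ f∈ with All.lookupAny (all-boldAt t) (Any.map⁻ (∈-⋃⁻ (map _ (boldLinks t)) f∈))
    ... | b , f∈e = adh⊆adhₙ b (proj₁ (side⁻ f∈e))

  -- If `e` separated neither end of `f` from `t`, walks avoiding `e` would join the two ends
  -- through `t`, and `f` would not cross `e`.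
  adh⊆cutSides : ∀ t e → adh e ⊆ cutSide proj₁ t e ∪ cutSide proj₂ t e
  adh⊆cutSides t e {f} f∈ with walk? (⊤ - e) (nodeOf (proj₁ (ends f))) t
                             | walk? (⊤ - e) (nodeOf (proj₂ (ends f))) t
  ... | no s  | _     = x∈p∪q⁺ (inj₁ (x∈p∩q⁺ (f∈ , ∈-⟪⟫⁺ (λ f → separates? t e (nodeOf (proj₁ (ends f)))) s)))
  ... | yes _ | no s  = x∈p∪q⁺ (inj₂ (x∈p∩q⁺ (f∈ , ∈-⟪⟫⁺ (λ f → separates? t e (nodeOf (proj₂ (ends f)))) s)))
  ... | yes p | yes q = contradiction (p ◅◅ walk-reverse q) (∈-⟪⟫⁻ (λ f → crosses? f e) f∈)

  ∣boldLinks∣≤∣adhₙ∣ : ∀ t → length (boldLinks t) ≤ ∣ adhₙ t ∣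
  -- The 2 on the left is the lower bound `two≤` for each link; on the right it counts the two
  -- projections.
  ∣boldLinks∣≤∣adhₙ∣ t = *-cancelʳ-≤ _ ∣ adhₙ t ∣ 2 (begin
    length (boldLinks t) * 2   ≤⟨ length*≤sum+sum _ _ (All.map (λ {e} → two≤ {e}) (all-boldAt t)) ⟩
    sum (map (∣_∣ ∘ cutSide proj₁ t) (boldLinks t)) +
    sum (map (∣_∣ ∘ cutSide proj₂ t) (boldLinks t))
                               ≤⟨ +-mono-≤ (sum-cutSide≤∣adhₙ∣ proj₁ t) (sum-cutSide≤∣adhₙ∣ proj₂ t) ⟩
    ∣ adhₙ t ∣ + ∣ adhₙ t ∣    ≡⟨ cong (∣ adhₙ t ∣ +_) (+-identityʳ ∣ adhₙ t ∣) ⟨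
    2 * ∣ adhₙ t ∣             ≡⟨ *-comm 2 ∣ adhₙ t ∣ ⟩
    ∣ adhₙ t ∣ * 2             ∎)
    where
    open ≤-Reasoning
    two≤ : ∀ {e} → BoldAt t e → 2 ≤ ∣ cutSide proj₁ t e ∣ + ∣ cutSide proj₂ t e ∣
    two≤ {e} (b , _) = begin
      2                                               ≤⟨ n≤1+n 2 ⟩
      3                                               ≤⟨ b ⟩
      ∣ adh e ∣                                       ≤⟨ p⊆q⇒∣p∣≤∣q∣ (adh⊆cutSides t e) ⟩
      ∣ cutSide proj₁ t e ∪ cutSide proj₂ t e ∣       ≤⟨ ∣p∪q∣≤∣p∣+∣q∣ (cutSide proj₁ t e) _ ⟩
      ∣ cutSide proj₁ t e ∣ + ∣ cutSide proj₂ t e ∣   ∎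

  -- Comparison of the widths.

  private
    k = gprtwWidth 𝒯
    a = adhesionWidth 𝒯
    b = bagWidth 𝒯

  maxₜ-lub : ∀ {m} (f : Node → ℕ) → (∀ t → f t ≤ m) → max 0 (map f (allFin #nodes)) ≤ m
  -- `z≤n` disposes of the default value 0.
  maxₜ-lub f f≤m = max≤v⁺ z≤n (All.map⁺ (All.universal f≤m (allFin #nodes)))

  maxₜ-upper : ∀ (f : Node → ℕ) t → f t ≤ max 0 (map f (allFin #nodes))
  maxₜ-upper f t = All.lookup (All.map⁻ (xs≤max 0 (map f (allFin #nodes)))) (∈-allFin t)

  private
    gprtw-parts : All (_≤ k) (map (λ e → ∣ adh e ∣) (allFin #links)) ×
                  All (_≤ k) (map w (allFin #nodes))
    gprtw-parts = All.++⁻ (map (λ e → ∣ adh e ∣) (allFin #links)) (xs≤max 0 _)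

  ∣adh∣≤gprtwWidth : ∀ e → ∣ adh e ∣ ≤ k
  ∣adh∣≤gprtwWidth e = All.lookup (All.map⁻ (proj₁ gprtw-parts)) (∈-allFin e)

  w≤gprtwWidth : ∀ t → w t ≤ k
  w≤gprtwWidth t = All.lookup (All.map⁻ (proj₂ gprtw-parts)) (∈-allFin t)

  adhesionWidth≤gprtwWidth² : a ≤ k ^ 2
  adhesionWidth≤gprtwWidth² = maxₜ-lub (λ t → ∣ adhₙ t ∣) λ t → begin
    ∣ adhₙ t ∣                ≤⟨ ∣⋃∣≤length* adh (All.universal ∣adh∣≤gprtwWidth (boldLinks t)) ⟩
    length (boldLinks t) * k  ≤⟨ *-monoˡ-≤ k (∣boldLinks∣≤∣boldNeighbours∣ t) ⟩
    ∣ boldNeighbours t ∣ * k  ≤⟨ *-monoˡ-≤ k (m≤n+m _ ∣ bag t ∣) ⟩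
    w t * k                   ≤⟨ *-monoˡ-≤ k (w≤gprtwWidth t) ⟩
    k * k                     ≡⟨ cong (k *_) (*-identityʳ k) ⟨
    k ^ 2                     ∎
    where open ≤-Reasoning

  bagWidth≤gprtwWidth : b ≤ k
  bagWidth≤gprtwWidth = maxₜ-lub (λ t → ∣ bag t ∣) λ t → ≤-trans (m≤m+n _ _) (w≤gprtwWidth t)

  -- The 2 pays for thin links, which `adhₙ` ignores but whose adhesion has at most two edges. The
  -- adhesion of a bold link lies in `adhₙ` of its first end.
  ∣adh∣≤adhesionWidth+2 : ∀ e → ∣ adh e ∣ ≤ a + 2
  ∣adh∣≤adhesionWidth+2 e with bold? e
  ... | no  ¬b = ≤-trans (s≤s⁻¹ (≰⇒> ¬b)) (m≤n+m 2 a)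
  ... | yes b  = begin
    ∣ adh e ∣   ≤⟨ p⊆q⇒∣p∣≤∣q∣ (adh⊆adhₙ (b , inj₁ refl)) ⟩
    ∣ adhₙ t ∣  ≤⟨ maxₜ-upper (λ t → ∣ adhₙ t ∣) t ⟩
    a           ≤⟨ m≤m+n a 2 ⟩
    a + 2       ∎
    where
    open ≤-Reasoning
    t = proj₁ (Graph.ends tree e)

  w≤adhesionWidth+bagWidth : ∀ t → w t ≤ a + b
  w≤adhesionWidth+bagWidth t = begin
    ∣ bag t ∣ + ∣ boldNeighbours t ∣  ≤⟨ +-mono-≤ (maxₜ-upper (λ t → ∣ bag t ∣) t) (∣boldNeighbours∣≤∣boldLinks∣ t) ⟩
    b + length (boldLinks t)          ≤⟨ +-monoʳ-≤ b (∣boldLinks∣≤∣adhₙ∣ t) ⟩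
    b + ∣ adhₙ t ∣                    ≤⟨ +-monoʳ-≤ b (maxₜ-upper (λ t → ∣ adhₙ t ∣) t) ⟩
    b + a                             ≡⟨ +-comm b a ⟩
    a + b                             ∎
    where open ≤-Reasoning

  -- Links contribute at most `a + 2` and nodes at most `a + b`; the bound dominates both.
  gprtwWidth≤adhesionWidth+bagWidth+2 : k ≤ a + b + 2
  gprtwWidth≤adhesionWidth+bagWidth+2 = max≤v⁺ z≤n (All.++⁺
    (All.map⁺ (All.universal (λ e → ≤-trans (∣adh∣≤adhesionWidth+2 e) (+-monoˡ-≤ 2 (m≤m+n a b)))
      (allFin #links)))
    (All.map⁺ (All.universal (λ t → ≤-trans (w≤adhesionWidth+bagWidth t) (m≤m+n (a + b) 2))
      (allFin #nodes))))

theorem3p4 : (G : Graph) (𝒯 : TreeCutDecomposition G) →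
    ((k : ℕ) → gprtwWidth 𝒯 ≡ k → adhesionWidth 𝒯 ≤ k ^ 2 × bagWidth 𝒯 ≤ k)
    × ((a b : ℕ) → adhesionWidth 𝒯 ≡ a → bagWidth 𝒯 ≡ b → gprtwWidth 𝒯 ≤ a + b + 2)
theorem3p4 G 𝒯 =
    (λ { _ refl → adhesionWidth≤gprtwWidth² G 𝒯 , bagWidth≤gprtwWidth G 𝒯 })
  , (λ { _ _ refl refl → gprtwWidth≤adhesionWidth+bagWidth+2 G 𝒯 })
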